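{- There exists a simple $4$-$(16,8,45)$ design.
   Context: A $t$-$(v,k,\lambda)$ design consists of a $v$-element set $P$ of points together with a collection $B$ of $k$-element subsets of $P$ (called blocks) such that every $t$-element subset of $P$ is contained in exactly $\lambda$ blocks. The design is simple if $B$ is a set, i.e. contains no repeated blocks. -}

module Defs where

open import Data.Nat using (ℕ)
open import Data.List using (List; length; filter)
open import Data.List.Relation.Unary.All using (All)
open import Data.List.Relation.Unary.Unique.Propositional using (Unique)
open import Data.Fin.Subset using (Subset; _⊆_; ∣_∣)
open import Data.Fin.Subset.Properties using (_⊆?_)
open import Relation.Binary.PropositionalEquality using (_≡_)

-- Point set P = Fin v; a block is a subset of Fin v (Subset v = Vec Bool v).
-- The collection of blocks is a list (a multiset); blocks may a priori repeat.

count : ∀ {v} → Subset v → List (Subset v) → ℕ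
count T blocks = length (filter (T ⊆?_) blocks)

record IsDesign (t v k lam : ℕ) (blocks : List (Subset v)) : Set where
  field
    blockSize : All (λ B → ∣ B ∣ ≡ k) blocks
    balanced  : ∀ (T : Subset v) → ∣ T ∣ ≡ t → count T blocks ≡ lam

IsSimple : ∀ {v} → List (Subset v) → Set
IsSimple blocks = Unique blocks

{-# OPTIONS --safe #-}

-- The affine group AGL(1,13) acts on the 16 points 𝔽₁₃ ∪ {∞₀, ∞₁, ∞₂}, where
-- x ↦ ax + b moves the points ∞ᵢ as multiplication by a moves the cosets of
-- the cubes of 𝔽₁₃ˣ. A union of 12 of the orbits on 8-sets (2 of length 39,
-- 6 of length 78 and 4 of length 156) consists of 1170 blocks and covers every
-- 4-set exactly 45 times. The orbits were found by solving the Kramer–Mesner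
-- system of this group; the balance condition is checked by computation.

module Submission where

open import Defs
open import Data.Bool using (Bool; true; false; _∧_; T)
open import Data.Bool.Properties using (T-∧)
open import Data.Fin using (toℕ)
open import Data.Fin.Subset using (Subset; inside; outside; ∣_∣)
open import Data.Fin.Subset.Properties using (_⊆?_)
open import Data.List using (List; []; _∷_; concatMap; iterate; length; map)
open import Data.List.Membership.DecPropositional using (_∈?_)
open import Data.List.Relation.Unary.All using (All; []; _∷_; all?)
open import Data.List.Relation.Unary.AllPairs using ([]; _∷_)
open import Data.List.Relation.Unary.Unique.Propositional using (Unique)
open import Data.Nat using (ℕ; zero; suc; _≡ᵇ_; _≟_)
open import Data.Nat.Properties using (≡ᵇ⇒≡; suc-injective)
open import Data.Product using (∃-syntax; _×_; _,_; proj₁; proj₂)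
open import Data.Vec using ([]; _∷_; tabulate; tail)
open import Data.Vec.Properties using (∷-injectiveʳ)
open import Function using (_∘_; Equivalence)
open import Relation.Binary.PropositionalEquality using (_≡_; _≢_; refl; cong; trans)
open import Relation.Nullary.Decidable using (does; toWitness)

private
  variable
    n : ℕ

T-∧⁻ : ∀ {x y} → T (x ∧ y) → T x × T y
T-∧⁻ = Equivalence.to T-∧

-- The derived (b = inside) or residual (b = outside) family at the first point.
section : Bool → List (Subset (suc n)) → List (Subset n)
section b     []                  = []
section true  ((true  ∷ B) ∷ Bs) = B ∷ section true Bs
section true  ((false ∷ B) ∷ Bs) = section true Bs
section false ((true  ∷ B) ∷ Bs) = section false Bs
section false ((false ∷ B) ∷ Bs) = B ∷ section false Bs

count-inside : ∀ (S : Subset n) Bs → count (inside ∷ S) Bs ≡ count S (section inside Bs)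
count-inside S []                = refl
count-inside S ((false ∷ B) ∷ Bs) = count-inside S Bs
count-inside S ((true ∷ B) ∷ Bs) with does (S ⊆? B)
... | true  = cong suc (count-inside S Bs)
... | false = count-inside S Bs

-- Blocks with and without the first point both stay; tails may coincide, so multiplicities matter.
count-outside : ∀ (S : Subset n) Bs → count (outside ∷ S) Bs ≡ count S (map tail Bs)
count-outside S []              = refl
count-outside S ((b ∷ B) ∷ Bs) with does (S ⊆? B)
... | true  = cong suc (count-outside S Bs)
... | false = count-outside S Bs

count-[] : ∀ Bs → count [] Bs ≡ length Bs
count-[] []        = refl
count-[] ([] ∷ Bs) = cong suc (count-[] Bs)

-- Running through the t-subsets point by point lets all t-subsets with a
-- common initial segment share the list of blocks containing that segment.
balancedᵇ : ∀ n (t lam : ℕ) → List (Subset n) → Bool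
balancedᵇ zero    zero    lam Bs = length Bs ≡ᵇ lam
balancedᵇ zero    (suc t) lam Bs = true
balancedᵇ (suc n) zero    lam Bs = balancedᵇ n zero lam (map tail Bs)
balancedᵇ (suc n) (suc t) lam Bs =
  balancedᵇ n (suc t) lam (map tail Bs) ∧ balancedᵇ n t lam (section inside Bs)

-- With no points left only the empty set remains, so the default `true` for `suc t` is vacuous.
balancedᵇ-sound : ∀ n t {lam} Bs → T (balancedᵇ n t lam Bs) →
                  ∀ (S : Subset n) → ∣ S ∣ ≡ t → count S Bs ≡ lam
balancedᵇ-sound zero zero Bs h [] _ = trans (count-[] Bs) (≡ᵇ⇒≡ (length Bs) _ h)
balancedᵇ-sound (suc n) zero Bs h (false ∷ S) eq =
  trans (count-outside S Bs) (balancedᵇ-sound n zero (map tail Bs) h S eq)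
balancedᵇ-sound (suc n) (suc t) Bs h (false ∷ S) eq =
  trans (count-outside S Bs) (balancedᵇ-sound n (suc t) (map tail Bs) (proj₁ (T-∧⁻ h)) S eq)
balancedᵇ-sound (suc n) (suc t) Bs h (true ∷ S) eq =
  trans (count-inside S Bs)
        (balancedᵇ-sound n t (section inside Bs) (proj₂ (T-∧⁻ h)) S (suc-injective eq))

-- Splitting point by point, as in a radix sort, ends with one list per subset and avoids comparing
-- all pairs of blocks.
distinctᵇ : ∀ n → List (Subset n) → Bool
distinctᵇ zero    []           = true
distinctᵇ zero    (_ ∷ [])     = true
distinctᵇ zero    (_ ∷ _ ∷ _) = false
distinctᵇ (suc n) Bs           = distinctᵇ n (section true Bs) ∧ distinctᵇ n (section false Bs)

-- Blocks outside the section already differ from `b ∷ B` at the first point.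
section-≢ : ∀ b {B : Subset n} Bs → All (B ≢_) (section b Bs) → All (b ∷ B ≢_) Bs
section-≢ b     []                 _          = []
section-≢ true  ((true  ∷ C) ∷ Bs) (B≢C ∷ h) = B≢C ∘ ∷-injectiveʳ ∷ section-≢ true Bs h
section-≢ true  ((false ∷ C) ∷ Bs) h          = (λ ()) ∷ section-≢ true Bs h
section-≢ false ((true  ∷ C) ∷ Bs) h          = (λ ()) ∷ section-≢ false Bs h
section-≢ false ((false ∷ C) ∷ Bs) (B≢C ∷ h) = B≢C ∘ ∷-injectiveʳ ∷ section-≢ false Bs h

section-unique : (Bs : List (Subset (suc n))) →
                 Unique (section true Bs) → Unique (section false Bs) → Unique Bs
section-unique []                 _        _        = []
section-unique ((true  ∷ B) ∷ Bs) (h ∷ u) v        = section-≢ true Bs h ∷ section-unique Bs u v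
section-unique ((false ∷ B) ∷ Bs) u        (h ∷ v) = section-≢ false Bs h ∷ section-unique Bs u v

distinctᵇ-sound : ∀ n Bs → T (distinctᵇ n Bs) → Unique Bs
distinctᵇ-sound zero    []       _ = []
distinctᵇ-sound zero    (_ ∷ []) _ = [] ∷ []
distinctᵇ-sound (suc n) Bs       h =
  section-unique Bs (distinctᵇ-sound n (section true Bs) (proj₁ (T-∧⁻ h)))
                    (distinctᵇ-sound n (section false Bs) (proj₂ (T-∧⁻ h)))

-- The points 0, …, 12 are the elements of 𝔽₁₃, and 13 + i is ∞ᵢ.
fromPoints : List ℕ → Subset 16
fromPoints ps = tabulate (λ i → does (_∈?_ _≟_ (toℕ i) ps))

-- Image of a block under x ↦ x + 1, ∞ᵢ ↦ ∞ᵢ.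
translate : Subset 16 → Subset 16
translate (a ∷ b ∷ c ∷ d ∷ e ∷ f ∷ g ∷ h ∷ i ∷ j ∷ k ∷ l ∷ m ∷ ∞s) =
  m ∷ a ∷ b ∷ c ∷ d ∷ e ∷ f ∷ g ∷ h ∷ i ∷ j ∷ k ∷ l ∷ ∞s

-- Image of a block under x ↦ 2x, ∞ᵢ ↦ ∞ᵢ₊₁; note that 2 is a primitive root mod 13.
double : Subset 16 → Subset 16
double (a ∷ b ∷ c ∷ d ∷ e ∷ f ∷ g ∷ h ∷ i ∷ j ∷ k ∷ l ∷ m ∷ u ∷ v ∷ w ∷ []) =
  a ∷ h ∷ b ∷ i ∷ c ∷ j ∷ d ∷ k ∷ e ∷ l ∷ f ∷ m ∷ g ∷ w ∷ u ∷ v ∷ []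

-- A block whose stabiliser has order 12 / m has the maps x ↦ 2ⁱx + b with i < m
-- as a transversal, so its orbit is listed without repetition.
orbit : ℕ × List ℕ → List (Subset 16)
orbit (m , ps) = concatMap (λ B → iterate translate B 13) (iterate double (fromPoints ps) m)

-- Orbit lengths are 13m, with total 2·39 + 6·78 + 4·156 = 1170 = 45·C(16,4)/C(8,4).
baseBlocks : List (ℕ × List ℕ)
baseBlocks =
  (3  , 0 ∷ 1 ∷ 2 ∷ 3 ∷ 4 ∷ 5 ∷ 8 ∷ 10 ∷ []) ∷
  (3  , 0 ∷ 1 ∷ 2 ∷ 6 ∷ 9 ∷ 13 ∷ 14 ∷ 15 ∷ []) ∷
  (6  , 0 ∷ 1 ∷ 2 ∷ 3 ∷ 4 ∷ 5 ∷ 7 ∷ 11 ∷ []) ∷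
  (6  , 0 ∷ 1 ∷ 2 ∷ 3 ∷ 4 ∷ 5 ∷ 13 ∷ 15 ∷ []) ∷
  (6  , 0 ∷ 1 ∷ 2 ∷ 3 ∷ 4 ∷ 6 ∷ 11 ∷ 14 ∷ []) ∷
  (6  , 0 ∷ 1 ∷ 2 ∷ 3 ∷ 4 ∷ 6 ∷ 11 ∷ 15 ∷ []) ∷
  (6  , 0 ∷ 1 ∷ 2 ∷ 3 ∷ 7 ∷ 9 ∷ 14 ∷ 15 ∷ []) ∷
  (6  , 0 ∷ 1 ∷ 2 ∷ 3 ∷ 8 ∷ 13 ∷ 14 ∷ 15 ∷ []) ∷
  (12 , 0 ∷ 1 ∷ 2 ∷ 3 ∷ 4 ∷ 6 ∷ 8 ∷ 13 ∷ []) ∷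
  (12 , 0 ∷ 1 ∷ 2 ∷ 3 ∷ 5 ∷ 6 ∷ 9 ∷ 13 ∷ []) ∷
  (12 , 0 ∷ 1 ∷ 2 ∷ 3 ∷ 5 ∷ 7 ∷ 14 ∷ 15 ∷ []) ∷
  (12 , 0 ∷ 1 ∷ 2 ∷ 3 ∷ 6 ∷ 8 ∷ 13 ∷ 14 ∷ []) ∷ []

designBlocks : List (Subset 16)
designBlocks = concatMap orbit baseBlocks

designBlocks-isDesign : IsDesign 4 16 8 45 designBlocks
designBlocks-isDesign = record
  { blockSize = toWitness {a? = all? (λ B → ∣ B ∣ ≟ 8) designBlocks} _
  ; balanced  = balancedᵇ-sound 16 4 designBlocks _
  }

theorem7 : ∃[ blocks ] (IsDesign 4 16 8 45 blocks × IsSimple {16} blocks)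
theorem7 = designBlocks , designBlocks-isDesign , distinctᵇ-sound 16 designBlocks _
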